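{- A typable term of $\lambda^{\textsc{prk}}$ is generated by the grammar of normal terms $$N ::= S\mid\langle N,N\rangle^\pm\mid\mathsf{in}_i^\pm(N)\mid\nu^\pm N\mid\mathsf{IC}^\pm_{(x:P)}.N$$ $$S ::= x\mid\pi_i^\pm(S)\mid\delta^\pm S[_x.N][_y.N]\mid\mu^\pm S\mid S\bullet^\pm N\mid S\blacktriangleright\!\blacktriangleleft_P N\mid N\blacktriangleright\!\blacktriangleleft_P S$$ (where $N$ ranges over normal terms, $S$ over neutral terms, $i\in\{1,2\}$, $\pm\in\{+,-\}$, and the different occurrences of $N$ in a production stand for possibly different normal terms) if and only if it is a normal form, i.e. it does not reduce in $\lambda^{\textsc{prk}}$.
   Context: **Types.** Fix a denumerable set of propositional variables $\alpha$. Pure propositions: $A,B ::= \alpha \mid A\land B\mid A\lor B\mid \neg A$. Types (moded propositions): $P,Q ::= A^+\mid A^-\mid A^\oplus\mid A^\ominus$; $A^+,A^-$ are strong, $A^\oplus,A^\ominus$ classical. Opposite: $(A^+)^\sim=A^-$, $(A^-)^\sim=A^+$, $(A^\oplus)^\sim=A^\ominus$, $(A^\ominus)^\sim=A^\oplus$. **Terms of $\lambda^{\textsc{prk}}$.** ($i\in\{1,2\}$, $\pm\in\{+,-\}$; $x,y$ from a denumerable set of variables) $$t,s,u ::= x \mid t\blacktriangleright\!\blacktriangleleft_P s\mid \langle t,s\rangle^\pm\mid \pi_i^\pm(t)\mid \mathsf{in}_i^\pm(t)\mid \delta^\pm t[_{x:P}.s][_{y:Q}.u]\mid \nu^\pm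 t\mid \mu^\pm t\mid \mathsf{IC}^\pm_{(x:P)}.t\mid t\bullet^\pm s.$$ In $\delta^\pm t[_{x:P}.s][_{y:Q}.u]$, $x$ is bound in $s$ and $y$ in $u$; in $\mathsf{IC}^\pm_{(x:P)}.t$, $x$ is bound in $t$. Terms are taken modulo $\alpha$-renaming; $t[x:=s]$ is capture-avoiding substitution. Type annotations may be omitted. **Typing.** Typing contexts $\Gamma$ are finite lists $x_1:P_1,\dots,x_n:P_n$ with distinct variables, up to reordering. A term $t$ is typable if $\Gamma\vdash t:P$ for some $\Gamma,P$. Rules: - (Ax) $\Gamma,x:P\vdash x:P$. (Abs) $\Gamma\vdash t:P$, $\Gamma\vdash s:P^\sim$, $P$ strong $\Rightarrow$ $\Gamma\vdash t\blacktriangleright\!\blacktriangleleft_Q s:Q$. - $\Gamma\vdash t:A^\oplus$, $\Gamma\vdash s:B^\oplus$ $\Rightarrow$ $\Gamma\vdash\langle t,s\rangle^+:(A\land B)^+$. $\Gamma\vdash t:A^\ominus$, $\Gamma\vdash s:B^\ominus$ $\Rightarrow$ $\Gamma\vdash\langle t,s\rangle^-:(A\lor B)^-$. - $\Gamma\vdash t:(A_1\land A_2)^+$ $\Rightarrow$ $\Gamma\vdash\pi^+_i(t):A_i^\oplus$. $\Gamma\vdash t:(A_1\lor A_2)^-$ $\Rightarrow$ $\Gamma\vdash\pi^-_i(t):A_i^\ominus$. - $\Gamma\vdash t:A_i^\oplus$ $\Rightarrow$ $\Gamma\vdash\mathsf{in}^+_i(t):(A_1\lor A_2)^+$. $\Gamma\vdash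 t:A_i^\ominus$ $\Rightarrow$ $\Gamma\vdash\mathsf{in}^-_i(t):(A_1\land A_2)^-$. - $\Gamma\vdash t:(A\lor B)^+$, $\Gamma,x:A^\oplus\vdash s:P$, $\Gamma,y:B^\oplus\vdash u:P$ $\Rightarrow$ $\Gamma\vdash\delta^+t[_{x:A^\oplus}.s][_{y:B^\oplus}.u]:P$. $\Gamma\vdash t:(A\land B)^-$, $\Gamma,x:A^\ominus\vdash s:P$, $\Gamma,y:B^\ominus\vdash u:P$ $\Rightarrow$ $\Gamma\vdash\delta^-t[_{x:A^\ominus}.s][_{y:B^\ominus}.u]:P$. - $\Gamma\vdash t:A^\ominus$ $\Rightarrow$ $\Gamma\vdash\nu^+t:(\neg A)^+$. $\Gamma\vdash t:A^\oplus$ $\Rightarrow$ $\Gamma\vdash\nu^-t:(\neg A)^-$. $\Gamma\vdash t:(\neg A)^+$ $\Rightarrow$ $\Gamma\vdash\mu^+t:A^\ominus$. $\Gamma\vdash t:(\neg A)^-$ $\Rightarrow$ $\Gamma\vdash\mu^-t:A^\oplus$. - $\Gamma,x:A^\ominus\vdash t:A^+$ $\Rightarrow$ $\Gamma\vdash\mathsf{IC}^+_{(x:A^\ominus)}.t:A^\oplus$. $\Gamma,x:A^\oplus\vdash t:A^-$ $\Rightarrow$ $\Gamma\vdash\mathsf{IC}^-_{(x:A^\oplus)}.t:A^\ominus$. - $\Gamma\vdash t:A^\oplus$, $\Gamma\vdash s:A^\ominus$ $\Rightarrow$ $\Gamma\vdash t\bullet^+s:A^+$. $\Gamma\vdash t:A^\ominus$,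 $\Gamma\vdash s:A^\oplus$ $\Rightarrow$ $\Gamma\vdash t\bullet^-s:A^-$. **Generalized absurdity.** For $t:P$ and $s:P^\sim$, $t\bowtie_Q s$ denotes: $t\blacktriangleright\!\blacktriangleleft_Q s$ if $P$ is strong; $(t\bullet^+s)\blacktriangleright\!\blacktriangleleft_Q(s\bullet^-t)$ if $P=A^\oplus$; $(t\bullet^-s)\blacktriangleright\!\blacktriangleleft_Q(s\bullet^+t)$ if $P=A^\ominus$. **Reduction.** $\to$ is defined on typable terms as the closure under arbitrary contexts of the following rules (in each rule all $\pm$ denote the same sign, $\mp$ the opposite sign, and $i\in\{1,2\}$): - $\pi_i^\pm(\langle t_1,t_2\rangle^\pm)\to t_i$; - $\delta^\pm(\mathsf{in}_i^\pm(t))[_x.s_1][_x.s_2]\to s_i[x:=t]$; - $\mu^\pm(\nu^\pm t)\to t$; - $(\mathsf{IC}^\pm_x.t)\bullet^\pm s\to t[x:=s]$; - $\langle t_1,t_2\rangle^\pm\blacktriangleright\!\blacktriangleleft_Q\mathsf{in}_i^\mp(s)\to t_i\bowtie_Q s$; - $\mathsf{in}_i^\pm(t)\blacktriangleright\!\blacktriangleleft_Q\langle s_1,s_2\rangle^\mp\to t\bowtie_Q s_i$; - $(\nu^\pm t)\blacktriangleright\!\blacktriangleleft_Q(\nu^\mp s)\to t\bowtie_Q s$. -}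

module Defs where

open import Data.Fin.Base using (Fin; zero; suc)
open import Data.Fin.Patterns using (0F; 1F)
open import Data.Nat.Base using (ℕ; suc)
open import Data.Product.Base using (∃; ∃-syntax; _×_)
open import Data.Sign.Base using (Sign; +; -; opposite)
open import Data.Vec.Base using (Vec; _∷_; _[_]=_)
open import Relation.Nullary.Negation.Core using (¬_)

infix  4 _⊢_∶_ _⊢_⇝_ _⟶_
infixr 8 _∧_
infixr 7 _∨_
infix  9 ¬'_
infix  6 _⁺ _⁻ _⊕ _⊖
infix  6 _∼

data Pure : Set where
  atom    : ℕ → Pure
  _∧_ _∨_ : Pure → Pure → Pure
  ¬'_     : Pure → Pure

data Type : Set where
  _⁺ _⁻ _⊕ _⊖ : Pure → Type

_∼ : Type → Type
(A ⁺) ∼ = A ⁻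
(A ⁻) ∼ = A ⁺
(A ⊕) ∼ = A ⊖
(A ⊖) ∼ = A ⊕

data Strong : Type → Set where
  strong⁺ : ∀ {A} → Strong (A ⁺)
  strong⁻ : ∀ {A} → Strong (A ⁻)

-- Terms modulo α-renaming, as well-scoped de Bruijn terms: Term n has its free
-- variables in Fin n, and index 0 is the innermost binder. The indices i ∈ {1,2}
-- of π, in and δ are 0F and 1F.
data Term (n : ℕ) : Set where
  var  : Fin n → Term n
  -- abs P t s is t ▶◀_P s
  abs  : Type → Term n → Term n → Term n
  pair : Sign → Term n → Term n → Term n
  π    : Sign → Fin 2 → Term n → Term n
  inj  : Sign → Fin 2 → Term n → Term n
  -- δ ± t P s Q u is δ± t [x:P. s] [y:Q. u]
  δ    : Sign → Term n → Type → Term (suc n) → Type → Term (suc n) → Term n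
  ν μ  : Sign → Term n → Term n
  IC   : Sign → Type → Term (suc n) → Term n
  -- app ± t s is t •± s
  app  : Sign → Term n → Term n → Term n

private
  variable
    m n : ℕ

pick : {X : Set} → Fin 2 → X → X → X
pick 0F x y = x
pick 1F x y = y

extᵣ : (Fin m → Fin n) → Fin (suc m) → Fin (suc n)
extᵣ ρ zero    = zero
extᵣ ρ (suc x) = suc (ρ x)

rename : (Fin m → Fin n) → Term m → Term n
rename ρ (var x)         = var (ρ x)
rename ρ (abs P t s)     = abs P (rename ρ t) (rename ρ s)
rename ρ (pair p t s)    = pair p (rename ρ t) (rename ρ s)
rename ρ (π p i t)       = π p i (rename ρ t)
rename ρ (inj p i t)     = inj p i (rename ρ t)
rename ρ (δ p t P s Q u) = δ p (rename ρ t) P (rename (extᵣ ρ) s) Q (rename (extᵣ ρ) u)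
rename ρ (ν p t)         = ν p (rename ρ t)
rename ρ (μ p t)         = μ p (rename ρ t)
rename ρ (IC p P t)      = IC p P (rename (extᵣ ρ) t)
rename ρ (app p t s)     = app p (rename ρ t) (rename ρ s)

ext : (Fin m → Term n) → Fin (suc m) → Term (suc n)
ext σ zero    = var zero
ext σ (suc x) = rename suc (σ x)

subst : (Fin m → Term n) → Term m → Term n
subst σ (var x)         = σ x
subst σ (abs P t s)     = abs P (subst σ t) (subst σ s)
subst σ (pair p t s)    = pair p (subst σ t) (subst σ s)
subst σ (π p i t)       = π p i (subst σ t)
subst σ (inj p i t)     = inj p i (subst σ t)
subst σ (δ p t P s Q u) = δ p (subst σ t) P (subst (ext σ) s) Q (subst (ext σ) u)
subst σ (ν p t)         = ν p (subst σ t)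
subst σ (μ p t)         = μ p (subst σ t)
subst σ (IC p P t)      = IC p P (subst (ext σ) t)
subst σ (app p t s)     = app p (subst σ t) (subst σ s)

-- t [ s ] replaces index 0 by s and lowers the remaining free variables.
_[_] : Term (suc n) → Term n → Term n
t [ s ] = subst (λ { zero → s ; (suc x) → var x }) t

Ctx : ℕ → Set
Ctx = Vec Type

data _⊢_∶_ {n} (Γ : Ctx n) : Term n → Type → Set where
  ⊢var   : ∀ {x P} → Γ [ x ]= P → Γ ⊢ var x ∶ P
  ⊢abs   : ∀ {P Q t s} → Strong P → Γ ⊢ t ∶ P → Γ ⊢ s ∶ P ∼ → Γ ⊢ abs Q t s ∶ Q
  ⊢pair⁺ : ∀ {A B t s} → Γ ⊢ t ∶ A ⊕ → Γ ⊢ s ∶ B ⊕ → Γ ⊢ pair + t s ∶ (A ∧ B) ⁺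
  ⊢pair⁻ : ∀ {A B t s} → Γ ⊢ t ∶ A ⊖ → Γ ⊢ s ∶ B ⊖ → Γ ⊢ pair - t s ∶ (A ∨ B) ⁻
  ⊢π⁺    : ∀ {A B t} i → Γ ⊢ t ∶ (A ∧ B) ⁺ → Γ ⊢ π + i t ∶ (pick i A B) ⊕
  ⊢π⁻    : ∀ {A B t} i → Γ ⊢ t ∶ (A ∨ B) ⁻ → Γ ⊢ π - i t ∶ (pick i A B) ⊖
  ⊢inj⁺  : ∀ {A B t} i → Γ ⊢ t ∶ (pick i A B) ⊕ → Γ ⊢ inj + i t ∶ (A ∨ B) ⁺
  ⊢inj⁻  : ∀ {A B t} i → Γ ⊢ t ∶ (pick i A B) ⊖ → Γ ⊢ inj - i t ∶ (A ∧ B) ⁻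
  ⊢δ⁺    : ∀ {A B P t s u} → Γ ⊢ t ∶ (A ∨ B) ⁺ →
           A ⊕ ∷ Γ ⊢ s ∶ P → B ⊕ ∷ Γ ⊢ u ∶ P →
           Γ ⊢ δ + t (A ⊕) s (B ⊕) u ∶ P
  ⊢δ⁻    : ∀ {A B P t s u} → Γ ⊢ t ∶ (A ∧ B) ⁻ →
           A ⊖ ∷ Γ ⊢ s ∶ P → B ⊖ ∷ Γ ⊢ u ∶ P →
           Γ ⊢ δ - t (A ⊖) s (B ⊖) u ∶ P
  ⊢ν⁺    : ∀ {A t} → Γ ⊢ t ∶ A ⊖ → Γ ⊢ ν + t ∶ (¬' A) ⁺
  ⊢ν⁻    : ∀ {A t} → Γ ⊢ t ∶ A ⊕ → Γ ⊢ ν - t ∶ (¬' A) ⁻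
  ⊢μ⁺    : ∀ {A t} → Γ ⊢ t ∶ (¬' A) ⁺ → Γ ⊢ μ + t ∶ A ⊖
  ⊢μ⁻    : ∀ {A t} → Γ ⊢ t ∶ (¬' A) ⁻ → Γ ⊢ μ - t ∶ A ⊕
  ⊢IC⁺   : ∀ {A t} → A ⊖ ∷ Γ ⊢ t ∶ A ⁺ → Γ ⊢ IC + (A ⊖) t ∶ A ⊕
  ⊢IC⁻   : ∀ {A t} → A ⊕ ∷ Γ ⊢ t ∶ A ⁻ → Γ ⊢ IC - (A ⊕) t ∶ A ⊖
  ⊢app⁺  : ∀ {A t s} → Γ ⊢ t ∶ A ⊕ → Γ ⊢ s ∶ A ⊖ → Γ ⊢ app + t s ∶ A ⁺
  ⊢app⁻  : ∀ {A t s} → Γ ⊢ t ∶ A ⊖ → Γ ⊢ s ∶ A ⊕ → Γ ⊢ app - t s ∶ A ⁻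

Typable : Term n → Set
Typable {n} t = ∃[ Γ ] ∃[ P ] Γ ⊢ t ∶ P

-- bowtie P Q t s is t ⋈_Q s for t of type P and s of type P ∼.
bowtie : Type → Type → Term n → Term n → Term n
bowtie (A ⁺) Q t s = abs Q t s
bowtie (A ⁻) Q t s = abs Q t s
bowtie (A ⊕) Q t s = abs Q (app + t s) (app - s t)
bowtie (A ⊖) Q t s = abs Q (app - t s) (app + s t)

-- Contextual closure of the reduction rules. The typing context is carried along
-- only because t ⋈_Q s depends on the type of t; terms are not yet required to be
-- typable, which is imposed in _⟶_.
data _⊢_⇝_ {n} (Γ : Ctx n) : Term n → Term n → Set where
  β-π   : ∀ {p i t₁ t₂} → Γ ⊢ π p i (pair p t₁ t₂) ⇝ pick i t₁ t₂
  β-δ   : ∀ {p i t P₁ P₂ s₁ s₂} →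
          Γ ⊢ δ p (inj p i t) P₁ s₁ P₂ s₂ ⇝ pick i s₁ s₂ [ t ]
  β-μ   : ∀ {p t} → Γ ⊢ μ p (ν p t) ⇝ t
  β-app : ∀ {p P t s} → Γ ⊢ app p (IC p P t) s ⇝ t [ s ]
  β-pair-inj : ∀ {p i t₁ t₂ s P Q} →
    Γ ⊢ pick i t₁ t₂ ∶ P → Γ ⊢ s ∶ P ∼ →
    Γ ⊢ abs Q (pair p t₁ t₂) (inj (opposite p) i s) ⇝ bowtie P Q (pick i t₁ t₂) s
  β-inj-pair : ∀ {p i t s₁ s₂ P Q} →
    Γ ⊢ t ∶ P → Γ ⊢ pick i s₁ s₂ ∶ P ∼ →
    Γ ⊢ abs Q (inj p i t) (pair (opposite p) s₁ s₂) ⇝ bowtie P Q t (pick i s₁ s₂)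
  β-ν   : ∀ {p t s P Q} →
    Γ ⊢ t ∶ P → Γ ⊢ s ∶ P ∼ →
    Γ ⊢ abs Q (ν p t) (ν (opposite p) s) ⇝ bowtie P Q t s

  ξ-abs₁  : ∀ {Q t t' s} → Γ ⊢ t ⇝ t' → Γ ⊢ abs Q t s ⇝ abs Q t' s
  ξ-abs₂  : ∀ {Q t s s'} → Γ ⊢ s ⇝ s' → Γ ⊢ abs Q t s ⇝ abs Q t s'
  ξ-pair₁ : ∀ {p t t' s} → Γ ⊢ t ⇝ t' → Γ ⊢ pair p t s ⇝ pair p t' s
  ξ-pair₂ : ∀ {p t s s'} → Γ ⊢ s ⇝ s' → Γ ⊢ pair p t s ⇝ pair p t s'
  ξ-π     : ∀ {p i t t'} → Γ ⊢ t ⇝ t' → Γ ⊢ π p i t ⇝ π p i t'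
  ξ-inj   : ∀ {p i t t'} → Γ ⊢ t ⇝ t' → Γ ⊢ inj p i t ⇝ inj p i t'
  ξ-δ₁    : ∀ {p t t' P s Q u} → Γ ⊢ t ⇝ t' → Γ ⊢ δ p t P s Q u ⇝ δ p t' P s Q u
  ξ-δ₂    : ∀ {p t P s s' Q u} → P ∷ Γ ⊢ s ⇝ s' → Γ ⊢ δ p t P s Q u ⇝ δ p t P s' Q u
  ξ-δ₃    : ∀ {p t P s Q u u'} → Q ∷ Γ ⊢ u ⇝ u' → Γ ⊢ δ p t P s Q u ⇝ δ p t P s Q u'
  ξ-ν     : ∀ {p t t'} → Γ ⊢ t ⇝ t' → Γ ⊢ ν p t ⇝ ν p t'
  ξ-μ     : ∀ {p t t'} → Γ ⊢ t ⇝ t' → Γ ⊢ μ p t ⇝ μ p t'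
  ξ-IC    : ∀ {p P t t'} → P ∷ Γ ⊢ t ⇝ t' → Γ ⊢ IC p P t ⇝ IC p P t'
  ξ-app₁  : ∀ {p t t' s} → Γ ⊢ t ⇝ t' → Γ ⊢ app p t s ⇝ app p t' s
  ξ-app₂  : ∀ {p t s s'} → Γ ⊢ s ⇝ s' → Γ ⊢ app p t s ⇝ app p t s'

_⟶_ : Term n → Term n → Set
t ⟶ t' = ∃[ Γ ] ∃[ P ] (Γ ⊢ t ∶ P × Γ ⊢ t ⇝ t')

NormalForm : Term n → Set
NormalForm t = ¬ ∃ (t ⟶_)

mutual
  data Normal {n} : Term n → Set where
    neutral : ∀ {t} → Neutral t → Normal t
    pair    : ∀ {p t s} → Normal t → Normal s → Normal (pair p t s)
    inj     : ∀ {p i t} → Normal t → Normal (inj p i t)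
    ν       : ∀ {p t} → Normal t → Normal (ν p t)
    IC      : ∀ {p P t} → Normal t → Normal (IC p P t)

  data Neutral {n} : Term n → Set where
    var  : ∀ {x} → Neutral (var x)
    π    : ∀ {p i t} → Neutral t → Neutral (π p i t)
    δ    : ∀ {p t P s Q u} → Neutral t → Normal s → Normal u → Neutral (δ p t P s Q u)
    μ    : ∀ {p t} → Neutral t → Neutral (μ p t)
    app  : ∀ {p t s} → Neutral t → Normal s → Neutral (app p t s)
    absˡ : ∀ {P t s} → Neutral t → Normal s → Neutral (abs P t s)
    absʳ : ∀ {P t s} → Normal t → Neutral s → Neutral (abs P t s)

{-# OPTIONS --safe #-}
-- Normal terms contain no redex because introduction forms are not neutral; this
-- direction needs no typing. Conversely, typing yields progress: a normal term in
-- the principal position of an elimination, or on either side of an absurdity, is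
-- neutral or a matching introduction form, and in the latter case there is a redex.
module Submission where

open import Defs
open import Data.Fin.Patterns using (0F; 1F)
open import Data.Nat.Base using (ℕ)
open import Data.Product.Base using (∃; _,_)
open import Data.Sign.Base using (+; -)
open import Data.Sum.Base using (_⊎_; inj₁; inj₂)
open import Function.Base using (case_of_)
open import Function.Bundles using (_⇔_; mk⇔)
open import Relation.Nullary.Negation.Core using (¬_; contradiction)

private
  variable
    n : ℕ
    Γ : Ctx n
    P : Type

mutual
  normal-irreducible : ∀ {t t' : Term n} → Normal t → ¬ Γ ⊢ t ⇝ t'
  normal-irreducible (neutral s)  r           = neutral-irreducible s r
  normal-irreducible (pair t s)   (ξ-pair₁ r) = normal-irreducible t r
  normal-irreducible (pair t s)   (ξ-pair₂ r) = normal-irreducible s r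
  normal-irreducible (inj t)      (ξ-inj r)   = normal-irreducible t r
  normal-irreducible (ν t)        (ξ-ν r)     = normal-irreducible t r
  normal-irreducible (IC t)       (ξ-IC r)    = normal-irreducible t r

  -- No `β` clause arises: the principal subterm would be both neutral and an introduction form. On
  -- `abs` every `β` rule wants introduction forms on both sides, so one neutral side blocks it.
  neutral-irreducible : ∀ {t t' : Term n} → Neutral t → ¬ Γ ⊢ t ⇝ t'
  neutral-irreducible (π t)      (ξ-π r)    = neutral-irreducible t r
  neutral-irreducible (δ t s u)  (ξ-δ₁ r)   = neutral-irreducible t r
  neutral-irreducible (δ t s u)  (ξ-δ₂ r)   = normal-irreducible s r
  neutral-irreducible (δ t s u)  (ξ-δ₃ r)   = normal-irreducible u r
  neutral-irreducible (μ t)      (ξ-μ r)    = neutral-irreducible t r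
  neutral-irreducible (app t s)  (ξ-app₁ r) = neutral-irreducible t r
  neutral-irreducible (app t s)  (ξ-app₂ r) = normal-irreducible s r
  neutral-irreducible (absˡ t s) (ξ-abs₁ r) = neutral-irreducible t r
  neutral-irreducible (absˡ t s) (ξ-abs₂ r) = normal-irreducible s r
  neutral-irreducible (absʳ t s) (ξ-abs₁ r) = normal-irreducible t r
  neutral-irreducible (absʳ t s) (ξ-abs₂ r) = neutral-irreducible s r

Progress : Ctx n → Term n → Set
Progress Γ t = Normal t ⊎ ∃ (Γ ⊢ t ⇝_)

-- Meets the typing premise of `β-pair-inj` and `β-inj-pair` on the selected component, as `pick` is
-- stuck while `i` is a variable.
pick-⊕ : ∀ {A B} {t s : Term n} i →
         Γ ⊢ t ∶ A ⊕ → Γ ⊢ s ∶ B ⊕ → Γ ⊢ pick i t s ∶ pick i A B ⊕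
pick-⊕ 0F ⊢t ⊢s = ⊢t
pick-⊕ 1F ⊢t ⊢s = ⊢s

pick-⊖ : ∀ {A B} {t s : Term n} i →
         Γ ⊢ t ∶ A ⊖ → Γ ⊢ s ∶ B ⊖ → Γ ⊢ pick i t s ∶ pick i A B ⊖
pick-⊖ 0F ⊢t ⊢s = ⊢t
pick-⊖ 1F ⊢t ⊢s = ⊢s

-- The type index leaves at most one introduction form per type. Subderivations are kept for the
-- rules on `abs`, where they fix the reduct `bowtie`.
data Canonical (Γ : Ctx n) : Term n → Type → Set where
  neutral : ∀ {t P} → Neutral t → Canonical Γ t P
  pair⁺   : ∀ {A B t s} → Γ ⊢ t ∶ A ⊕ → Γ ⊢ s ∶ B ⊕ → Canonical Γ (pair + t s) ((A ∧ B) ⁺)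
  pair⁻   : ∀ {A B t s} → Γ ⊢ t ∶ A ⊖ → Γ ⊢ s ∶ B ⊖ → Canonical Γ (pair - t s) ((A ∨ B) ⁻)
  inj⁺    : ∀ {A B t} i → Γ ⊢ t ∶ pick i A B ⊕ → Canonical Γ (inj + i t) ((A ∨ B) ⁺)
  inj⁻    : ∀ {A B t} i → Γ ⊢ t ∶ pick i A B ⊖ → Canonical Γ (inj - i t) ((A ∧ B) ⁻)
  ν⁺      : ∀ {A t} → Γ ⊢ t ∶ A ⊖ → Canonical Γ (ν + t) ((¬' A) ⁺)
  ν⁻      : ∀ {A t} → Γ ⊢ t ∶ A ⊕ → Canonical Γ (ν - t) ((¬' A) ⁻)
  IC⁺     : ∀ {A t} → Canonical Γ (IC + (A ⊖) t) (A ⊕)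
  IC⁻     : ∀ {A t} → Canonical Γ (IC - (A ⊕) t) (A ⊖)

canonical : ∀ {t : Term n} → Normal t → Γ ⊢ t ∶ P → Canonical Γ t P
canonical (neutral t) _ = neutral t
canonical (pair _ _)  (⊢pair⁺ ⊢t ⊢s) = pair⁺ ⊢t ⊢s
canonical (pair _ _)  (⊢pair⁻ ⊢t ⊢s) = pair⁻ ⊢t ⊢s
canonical (inj _)     (⊢inj⁺ i ⊢t)   = inj⁺ i ⊢t
canonical (inj _)     (⊢inj⁻ i ⊢t)   = inj⁻ i ⊢t
canonical (ν _)       (⊢ν⁺ ⊢t)       = ν⁺ ⊢t
canonical (ν _)       (⊢ν⁻ ⊢t)       = ν⁻ ⊢t
canonical (IC _)      (⊢IC⁺ _)       = IC⁺
canonical (IC _)      (⊢IC⁻ _)       = IC⁻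

-- `Strong P` excludes the `IC` forms. At opposite strong types a pair can only face an injection
-- and `ν` only `ν`, always a redex. Normality is passed along for the other side of `absˡ` and
-- `absʳ`.
progress-abs : ∀ {Q} {t s : Term n} → Strong P → Normal t → Normal s →
               Canonical Γ t P → Canonical Γ s (P ∼) → Progress Γ (abs Q t s)
progress-abs _       _ s (neutral t) _           = inj₁ (neutral (absˡ t s))
progress-abs _       t _ _           (neutral s) = inj₁ (neutral (absʳ t s))
progress-abs strong⁺ _ _ (pair⁺ ⊢t₁ ⊢t₂) (inj⁻ i ⊢s) =
  inj₂ (_ , β-pair-inj (pick-⊕ i ⊢t₁ ⊢t₂) ⊢s)
progress-abs strong⁻ _ _ (pair⁻ ⊢t₁ ⊢t₂) (inj⁺ i ⊢s) =
  inj₂ (_ , β-pair-inj (pick-⊖ i ⊢t₁ ⊢t₂) ⊢s)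
progress-abs strong⁺ _ _ (inj⁺ i ⊢t) (pair⁻ ⊢s₁ ⊢s₂) =
  inj₂ (_ , β-inj-pair ⊢t (pick-⊖ i ⊢s₁ ⊢s₂))
progress-abs strong⁻ _ _ (inj⁻ i ⊢t) (pair⁺ ⊢s₁ ⊢s₂) =
  inj₂ (_ , β-inj-pair ⊢t (pick-⊕ i ⊢s₁ ⊢s₂))
progress-abs strong⁺ _ _ (ν⁺ ⊢t) (ν⁻ ⊢s) = inj₂ (_ , β-ν ⊢t ⊢s)
progress-abs strong⁻ _ _ (ν⁻ ⊢t) (ν⁺ ⊢s) = inj₂ (_ , β-ν ⊢t ⊢s)

-- `f` is the one-hole context around `s`; `Δ` extends `Γ` when the hole is under a binder. Chained
-- continuations take the first subterm that steps, or else reach the root with every subterm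
-- normal.
step-or : ∀ {m} {Δ : Ctx m} {s : Term m} {t : Term n} {f : Term m → Term n} →
          (∀ {s'} → Δ ⊢ s ⇝ s' → Γ ⊢ t ⇝ f s') →
          Progress Δ s → (Normal s → Progress Γ t) → Progress Γ t
step-or ξ (inj₁ s)       k = k s
step-or ξ (inj₂ (_ , r)) k = inj₂ (_ , ξ r)

-- Induction on the typing derivation; `Γ` is arbitrary so that the bodies of `δ` and `IC` are
-- covered.
progress : ∀ {t : Term n} → Γ ⊢ t ∶ P → Progress Γ t
progress (⊢var _) = inj₁ (neutral var)
progress (⊢abs strong ⊢t ⊢s) =
  step-or ξ-abs₁ (progress ⊢t) λ t → step-or ξ-abs₂ (progress ⊢s) λ s →
  progress-abs strong t s (canonical t ⊢t) (canonical s ⊢s)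
progress (⊢pair⁺ ⊢t ⊢s) =
  step-or ξ-pair₁ (progress ⊢t) λ t → step-or ξ-pair₂ (progress ⊢s) λ s →
  inj₁ (pair t s)
progress (⊢pair⁻ ⊢t ⊢s) =
  step-or ξ-pair₁ (progress ⊢t) λ t → step-or ξ-pair₂ (progress ⊢s) λ s →
  inj₁ (pair t s)
progress (⊢π⁺ _ ⊢t) =
  step-or ξ-π (progress ⊢t) λ t →
  case canonical t ⊢t of λ
    { (neutral t) → inj₁ (neutral (π t))
    ; (pair⁺ _ _) → inj₂ (_ , β-π) }
progress (⊢π⁻ _ ⊢t) =
  step-or ξ-π (progress ⊢t) λ t →
  case canonical t ⊢t of λ
    { (neutral t) → inj₁ (neutral (π t))
    ; (pair⁻ _ _) → inj₂ (_ , β-π) }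
progress (⊢inj⁺ _ ⊢t) = step-or ξ-inj (progress ⊢t) λ t → inj₁ (inj t)
progress (⊢inj⁻ _ ⊢t) = step-or ξ-inj (progress ⊢t) λ t → inj₁ (inj t)
progress (⊢δ⁺ ⊢t ⊢s ⊢u) =
  step-or ξ-δ₁ (progress ⊢t) λ t → step-or ξ-δ₂ (progress ⊢s) λ s →
  step-or ξ-δ₃ (progress ⊢u) λ u →
  case canonical t ⊢t of λ
    { (neutral t) → inj₁ (neutral (δ t s u))
    ; (inj⁺ _ _) → inj₂ (_ , β-δ) }
progress (⊢δ⁻ ⊢t ⊢s ⊢u) =
  step-or ξ-δ₁ (progress ⊢t) λ t → step-or ξ-δ₂ (progress ⊢s) λ s →
  step-or ξ-δ₃ (progress ⊢u) λ u →
  case canonical t ⊢t of λ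
    { (neutral t) → inj₁ (neutral (δ t s u))
    ; (inj⁻ _ _) → inj₂ (_ , β-δ) }
progress (⊢ν⁺ ⊢t) = step-or ξ-ν (progress ⊢t) λ t → inj₁ (ν t)
progress (⊢ν⁻ ⊢t) = step-or ξ-ν (progress ⊢t) λ t → inj₁ (ν t)
progress (⊢μ⁺ ⊢t) =
  step-or ξ-μ (progress ⊢t) λ t →
  case canonical t ⊢t of λ
    { (neutral t) → inj₁ (neutral (μ t))
    ; (ν⁺ _) → inj₂ (_ , β-μ) }
progress (⊢μ⁻ ⊢t) =
  step-or ξ-μ (progress ⊢t) λ t →
  case canonical t ⊢t of λ
    { (neutral t) → inj₁ (neutral (μ t))
    ; (ν⁻ _) → inj₂ (_ , β-μ) }
progress (⊢IC⁺ ⊢t) = step-or ξ-IC (progress ⊢t) λ t → inj₁ (IC t)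
progress (⊢IC⁻ ⊢t) = step-or ξ-IC (progress ⊢t) λ t → inj₁ (IC t)
progress (⊢app⁺ ⊢t ⊢s) =
  step-or ξ-app₁ (progress ⊢t) λ t → step-or ξ-app₂ (progress ⊢s) λ s →
  case canonical t ⊢t of λ
    { (neutral t) → inj₁ (neutral (app t s))
    ; IC⁺ → inj₂ (_ , β-app) }
progress (⊢app⁻ ⊢t ⊢s) =
  step-or ξ-app₁ (progress ⊢t) λ t → step-or ξ-app₂ (progress ⊢s) λ s →
  case canonical t ⊢t of λ
    { (neutral t) → inj₁ (neutral (app t s))
    ; IC⁻ → inj₂ (_ , β-app) }

proposition34 : ∀ {n : ℕ} (t : Term n) → Typable t → Normal t ⇔ NormalForm t
proposition34 t (Γ , P , ⊢t) = mk⇔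
  -- The context hidden in `_⟶_` may differ from `Γ`; irreducibility holds in all contexts.
  (λ { N (_ , _ , _ , _ , r) → normal-irreducible N r })
  λ nf → case progress ⊢t of λ
    { (inj₁ N) → N
    -- `progress` steps in `Γ` itself, so `⊢t` completes the witness of `_⟶_`.
    ; (inj₂ (t' , r)) → contradiction (t' , Γ , P , ⊢t , r) nf }
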